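{- Let $L$ be a Hausdorff precompact co-Heyting algebra, and identify $L$ with its image in $\widehat L$ under the diagonal map $a\mapsto(\pi_d(a))_{d<\omega}$. Then for every positive integer $d$: (1) the ideals $dL$ and $d\widehat L$ are principal and $\varepsilon_d(L)=\varepsilon_d(\widehat L)$; (2) the closure of $dL$ in $\widehat L$ (for the projective topology) is $d\widehat L$, and the inclusion $L\subseteq\widehat L$ induces an isomorphism $L/dL\cong\widehat L/d\widehat L$. Consequently the projective topology on $\widehat L$ coincides with its codimetric topology, and $(\widehat L,\operatorname{dist}_{\widehat L})$ is the completion of the metric space $(L,\operatorname{dist}_L)$.
   Context: A co-Heyting algebra is a bounded distributive lattice $(L,0,1,\vee,\wedge)$ such that $a-b=\min\{c\in L: a\le b\vee c\}$ exists for all $a,b$. Let $a\triangle b=(a-b)\vee(b-a)$; for an ideal $I$, $L/I$ is the quotient by $a\equiv_I b\iff a\triangle b\in I$. $\operatorname{Spec}L$ is the set of prime filters ordered by inclusion; height = foundation rank there; $\operatorname{codim}_La=\min\{\operatorname{height}\mathfrak p: a\in\mathfrak p\}$ ($+\infty$ if none); $dL=\{a:\operatorname{codim}_La\ge d\}$ is an ideal, and $\varepsilon_d(L)$ denotes its generator when principal. $\pi_d:L\to L/dL$ is the canonical projection, and since $(d+1)L\subseteq dL$ there is a canonical surjection $\pi_{d,d+1}:L/(d+1)L\to L/dL$. $\widehat L=\{(x_d)_{d<\omega}: x_d\in L/dL,\ \pi_{d,d+1}(x_{d+1})=x_d\}$ is the projective limit, a co-Heyting algebra (subalgebra of the product),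 with the projective topology induced by the discrete topologies on the $L/dL$. The codimetric pseudometric of a co-Heyting algebra $M$ is $\operatorname{dist}_M(a,b)=2^{ -\operatorname{codim}_M(a\triangle b)}$ if finite, $0$ otherwise; the codimetric topology is the topology it defines. $L$ is Hausdorff if every nonzero element has finite codimension; $L$ is precompact if $L/dL$ is finite for every positive integer $d$. -}

module Defs where

open import Algebra.Core using (Op₂)
open import Algebra.Definitions using (_DistributesOverˡ_)
open import Axiom.ExcludedMiddle using (ExcludedMiddle)
open import Data.Fin.Base using (Fin)
open import Data.Integer.Base using (+_)
open import Data.List.Base using (List)
open import Data.List.Relation.Unary.All using (All)
open import Data.Nat.Base as ℕ using (ℕ; zero; suc; NonZero)
open import Data.Nat.Properties using (m^n≢0)
open import Data.Product using (_×_; _,_; Σ-syntax; ∃-syntax)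
open import Data.Rational.Base as ℚ using (ℚ; 0ℚ; _/_)
open import Data.Sum.Base using (_⊎_; inj₁; inj₂)
open import Function.Bundles using (Inverse; _⇔_)
open import Function.Definitions using (Congruent; Injective; Surjective)
open import Function.Metric.Rational.Core using (DistanceFunction)
open import Function.Metric.Rational.Structures using (IsMetric)
open import Level using (Level; _⊔_) renaming (suc to lsuc)
open import Relation.Binary.Bundles using (Setoid)
open import Relation.Binary.Core using (Rel)
open import Relation.Binary.Lattice using (BoundedLattice; DistributiveLattice; IsBoundedLattice)
import Relation.Binary.Lattice.Properties.DistributiveLattice as DistributiveProperties
import Relation.Binary.Lattice.Properties.JoinSemilattice as JoinProperties
open import Relation.Binary.PropositionalEquality.Core using (_≡_)
import Relation.Binary.PropositionalEquality.Properties as ≡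
open import Relation.Nullary.Decidable.Core using (Dec; yes; no)
open import Relation.Nullary.Negation.Core using (¬_; contradiction)
open import Relation.Unary using (Pred; _∈_; _∉_; _⊂_; _≬_)

private
  variable
    a b c c′ i ℓ₁ ℓ₂ ℓ₁′ ℓ₂′ o s u : Level

record CoHeytingAlgebra c ℓ₁ ℓ₂ : Set (lsuc (c ⊔ ℓ₁ ⊔ ℓ₂)) where
  infix  4 _≈_ _≤_
  infixr 6 _∨_
  infixr 7 _∧_
  infix  8 _-_ _△_
  field
    Carrier          : Set c
    _≈_              : Rel Carrier ℓ₁
    _≤_              : Rel Carrier ℓ₂
    _∨_              : Op₂ Carrier
    _∧_              : Op₂ Carrier
    _-_              : Op₂ Carrier
    ⊤                : Carrier
    ⊥                : Carrier
    isBoundedLattice : IsBoundedLattice _≈_ _≤_ _∨_ _∧_ ⊤ ⊥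
    ∧-distribˡ-∨     : _DistributesOverˡ_ _≈_ _∧_ _∨_
    x≤y∨[x-y]        : ∀ x y → x ≤ y ∨ x - y
    -least           : ∀ {x y z} → x ≤ y ∨ z → x - y ≤ z

  boundedLattice : BoundedLattice c ℓ₁ ℓ₂
  boundedLattice = record { isBoundedLattice = isBoundedLattice }

  open BoundedLattice boundedLattice public
    hiding (Carrier; _≈_; _≤_; _∨_; _∧_; ⊤; ⊥; isBoundedLattice)

  distributiveLattice : DistributiveLattice c ℓ₁ ℓ₂
  distributiveLattice = record
    { isDistributiveLattice = record
      { isLattice = isLattice ; ∧-distribˡ-∨ = ∧-distribˡ-∨ } }

  _△_ : Op₂ Carrier
  x △ y = x - y ∨ y - x

record IsCoHeytingIsomorphism
  (L : CoHeytingAlgebra c ℓ₁ ℓ₂) (M : CoHeytingAlgebra c′ ℓ₁′ ℓ₂′)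
  (f : CoHeytingAlgebra.Carrier L → CoHeytingAlgebra.Carrier M)
  : Set (c ⊔ ℓ₁ ⊔ c′ ⊔ ℓ₁′) where
  private
    module L = CoHeytingAlgebra L
    module M = CoHeytingAlgebra M
  field
    cong       : Congruent L._≈_ M._≈_ f
    injective  : Injective L._≈_ M._≈_ f
    surjective : Surjective L._≈_ M._≈_ f
    ∨-homo     : ∀ x y → f (x L.∨ y) M.≈ f x M.∨ f y
    ∧-homo     : ∀ x y → f (x L.∧ y) M.≈ f x M.∧ f y
    -‿homo     : ∀ x y → f (x L.- y) M.≈ f x M.- f y
    ⊤-homo     : f L.⊤ M.≈ M.⊤
    ⊥-homo     : f L.⊥ M.≈ M.⊥

record Ideal (L : CoHeytingAlgebra c ℓ₁ ℓ₂) (i : Level)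
  : Set (c ⊔ ℓ₂ ⊔ lsuc i) where
  open CoHeytingAlgebra L
  field
    member   : Pred Carrier i
    ⊥-closed : ⊥ ∈ member
    ∨-closed : ∀ {x y} → x ∈ member → y ∈ member → x ∨ y ∈ member
    ↓-closed : ∀ {x y} → x ≤ y → y ∈ member → x ∈ member

open Ideal public using (member)

IsGenerator : {L : CoHeytingAlgebra c ℓ₁ ℓ₂} → Ideal L i →
              Pred (CoHeytingAlgebra.Carrier L) (c ⊔ ℓ₂ ⊔ i)
IsGenerator {L = L} I e = ∀ x → x ∈ member I ⇔ x ≤ e
  where open CoHeytingAlgebra L

-- The quotient has the same carrier as L, with a coarser equality.  Its
-- order is "x ∨ y equals y modulo I"; since (x ∨ y) △ y = x - y, this
-- means x - y ∈ I.
module Quotient (L : CoHeytingAlgebra c ℓ₁ ℓ₂) (I : Ideal L i) where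
  open CoHeytingAlgebra L
  open Ideal I renaming (member to J)
  open JoinProperties joinSemilattice using (∨-monotonic; ∨-comm; ∨-assoc)
  open DistributiveProperties distributiveLattice using (∨-distribʳ-∧)

  infix 4 _≡ᴵ_ _≤ᴵ_

  _≡ᴵ_ : Rel Carrier i
  x ≡ᴵ y = x △ y ∈ J

  _≤ᴵ_ : Rel Carrier i
  x ≤ᴵ y = x - y ∈ J

  private
    ≤ᴵ-intro : ∀ {x y z} → z ∈ J → x ≤ y ∨ z → x ≤ᴵ y
    ≤ᴵ-intro z∈J x≤y∨z = ↓-closed (-least x≤y∨z) z∈J

  ≤⇒≤ᴵ : ∀ {x y} → x ≤ y → x ≤ᴵ y
  ≤⇒≤ᴵ x≤y = ≤ᴵ-intro ⊥-closed (trans x≤y (x≤x∨y _ _))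

  ≤ᴵ-trans : ∀ {x y z} → x ≤ᴵ y → y ≤ᴵ z → x ≤ᴵ z
  ≤ᴵ-trans {x} {y} {z} p q = ≤ᴵ-intro (∨-closed q p)
    (trans (x≤y∨[x-y] x y)
      (trans (∨-monotonic (x≤y∨[x-y] y z) refl)
             (reflexive (∨-assoc z (y - z) (x - y)))))

  ≤ᴵ-antisym : ∀ {x y} → x ≤ᴵ y → y ≤ᴵ x → x ≡ᴵ y
  ≤ᴵ-antisym = ∨-closed

  ≡ᴵ⇒≤ᴵ : ∀ {x y} → x ≡ᴵ y → x ≤ᴵ y
  ≡ᴵ⇒≤ᴵ = ↓-closed (x≤x∨y _ _)

  ≡ᴵ-sym : ∀ {x y} → x ≡ᴵ y → y ≡ᴵ x
  ≡ᴵ-sym = ↓-closed (reflexive (∨-comm _ _))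

  ≡ᴵ-trans : ∀ {x y z} → x ≡ᴵ y → y ≡ᴵ z → x ≡ᴵ z
  ≡ᴵ-trans p q = ≤ᴵ-antisym
    (≤ᴵ-trans (≡ᴵ⇒≤ᴵ p) (≡ᴵ⇒≤ᴵ q))
    (≤ᴵ-trans (≡ᴵ⇒≤ᴵ (≡ᴵ-sym q)) (≡ᴵ⇒≤ᴵ (≡ᴵ-sym p)))

  ≈⇒≡ᴵ : ∀ {x y} → x ≈ y → x ≡ᴵ y
  ≈⇒≡ᴵ x≈y = ≤ᴵ-antisym (≤⇒≤ᴵ (reflexive x≈y)) (≤⇒≤ᴵ (reflexive (Eq.sym x≈y)))

  ∨-leastᴵ : ∀ {x y z} → x ≤ᴵ z → y ≤ᴵ z → x ∨ y ≤ᴵ z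
  ∨-leastᴵ {x} {y} {z} p q = ≤ᴵ-intro (∨-closed p q) (∨-least
    (trans (x≤y∨[x-y] x z) (∨-monotonic refl (x≤x∨y _ _)))
    (trans (x≤y∨[x-y] y z) (∨-monotonic refl (y≤x∨y _ _))))

  ∧-greatestᴵ : ∀ {x y z} → x ≤ᴵ y → x ≤ᴵ z → x ≤ᴵ y ∧ z
  ∧-greatestᴵ {x} {y} {z} p q = ≤ᴵ-intro (∨-closed p q) (trans
    (∧-greatest
      (trans (x≤y∨[x-y] x y) (∨-monotonic refl (x≤x∨y _ _)))
      (trans (x≤y∨[x-y] x z) (∨-monotonic refl (y≤x∨y _ _))))
    (reflexive (Eq.sym (∨-distribʳ-∧ _ y z))))

  -‿leastᴵ : ∀ {x y z} → x ≤ᴵ y ∨ z → x - y ≤ᴵ z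
  -‿leastᴵ {x} {y} {z} p = ≤ᴵ-intro p (-least
    (trans (x≤y∨[x-y] x (y ∨ z)) (reflexive (∨-assoc _ _ _))))

  quotient : CoHeytingAlgebra c i i
  quotient = record
    { Carrier = Carrier ; _≈_ = _≡ᴵ_ ; _≤_ = _≤ᴵ_
    ; _∨_ = _∨_ ; _∧_ = _∧_ ; _-_ = _-_ ; ⊤ = ⊤ ; ⊥ = ⊥
    ; isBoundedLattice = record
      { isLattice = record
        { isPartialOrder = record
          { isPreorder = record
            { isEquivalence = record
              { refl  = ≈⇒≡ᴵ Eq.refl
              ; sym   = ≡ᴵ-sym
              ; trans = ≡ᴵ-trans
              }
            ; reflexive = ≡ᴵ⇒≤ᴵ
            ; trans     = ≤ᴵ-trans
            }
          ; antisym = ≤ᴵ-antisym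
          }
        ; supremum = λ x y →
            ≤⇒≤ᴵ (x≤x∨y x y) , ≤⇒≤ᴵ (y≤x∨y x y) , λ _ → ∨-leastᴵ
        ; infimum  = λ x y →
            ≤⇒≤ᴵ (x∧y≤x x y) , ≤⇒≤ᴵ (x∧y≤y x y) , λ _ → ∧-greatestᴵ
        }
      ; maximum = λ x → ≤⇒≤ᴵ (maximum x)
      ; minimum = λ x → ≤⇒≤ᴵ (minimum x)
      }
    ; ∧-distribˡ-∨ = λ x y z → ≈⇒≡ᴵ (∧-distribˡ-∨ x y z)
    ; x≤y∨[x-y]    = λ x y → ≤⇒≤ᴵ (x≤y∨[x-y] x y)
    ; -least       = -‿leastᴵ
    }

infix 9 _/ᴵ_

_/ᴵ_ : (L : CoHeytingAlgebra c ℓ₁ ℓ₂) → Ideal L i → CoHeytingAlgebra c i i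
L /ᴵ I = Quotient.quotient L I

module _ (L : CoHeytingAlgebra c ℓ₁ ℓ₂) where
  open CoHeytingAlgebra L

  record PrimeFilter : Set (lsuc (c ⊔ ℓ₁ ⊔ ℓ₂)) where
    field
      filter   : Pred Carrier (c ⊔ ℓ₁ ⊔ ℓ₂)
      ⊤-closed : ⊤ ∈ filter
      ∧-closed : ∀ {x y} → x ∈ filter → y ∈ filter → x ∧ y ∈ filter
      ↑-closed : ∀ {x y} → x ≤ y → x ∈ filter → y ∈ filter
      proper   : ⊥ ∉ filter
      prime    : ∀ {x y} → x ∨ y ∈ filter → x ∈ filter ⊎ y ∈ filter

  open PrimeFilter

  -- Height≥ n 𝔭 says that the foundation rank of 𝔭 in (Spec L, ⊂) is at
  -- least the finite ordinal n: every rank is ≥ 0, and rank 𝔭 ≥ n + 1 iff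
  -- rank 𝔮 ≥ n for some 𝔮 ⊂ 𝔭.  An infinite ordinal rank, or the rank ∞
  -- of a non-well-founded point, satisfies Height≥ n for all n.
  data Height≥ : ℕ → PrimeFilter → Set (lsuc (c ⊔ ℓ₁ ⊔ ℓ₂)) where
    h-zero : ∀ {𝔭} → Height≥ zero 𝔭
    h-suc  : ∀ {n 𝔭} 𝔮 → filter 𝔮 ⊂ filter 𝔭 → Height≥ n 𝔮 → Height≥ (suc n) 𝔭

  HasHeight : ℕ → PrimeFilter → Set (lsuc (c ⊔ ℓ₁ ⊔ ℓ₂))
  HasHeight n 𝔭 = Height≥ n 𝔭 × ¬ Height≥ (suc n) 𝔭

  Codim≥ : ℕ → Pred Carrier (lsuc (c ⊔ ℓ₁ ⊔ ℓ₂))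
  Codim≥ n x = ∀ 𝔭 → x ∈ filter 𝔭 → Height≥ n 𝔭

  HasCodim : ℕ → Pred Carrier (lsuc (c ⊔ ℓ₁ ⊔ ℓ₂))
  HasCodim n x = (∃[ 𝔭 ] x ∈ filter 𝔭 × HasHeight n 𝔭) × Codim≥ n x

  FiniteCodim : Pred Carrier (lsuc (c ⊔ ℓ₁ ⊔ ℓ₂))
  FiniteCodim x = ∃[ n ] HasCodim n x

  codimIdeal : ℕ → Ideal L (lsuc (c ⊔ ℓ₁ ⊔ ℓ₂))
  codimIdeal n = record
    { member   = Codim≥ n
    ; ⊥-closed = λ 𝔭 ⊥∈𝔭 → contradiction ⊥∈𝔭 (proper 𝔭)
    ; ∨-closed = λ {x} {y} hx hy 𝔭 x∨y∈𝔭 → split hx hy 𝔭 (prime 𝔭 x∨y∈𝔭)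
    ; ↓-closed = λ x≤y hy 𝔭 x∈𝔭 → hy 𝔭 (↑-closed 𝔭 x≤y x∈𝔭)
    }
    where
    split : ∀ {x y} → Codim≥ n x → Codim≥ n y → ∀ 𝔭 →
            x ∈ filter 𝔭 ⊎ y ∈ filter 𝔭 → Height≥ n 𝔭
    split hx hy 𝔭 (inj₁ x∈𝔭) = hx 𝔭 x∈𝔭
    split hx hy 𝔭 (inj₂ y∈𝔭) = hy 𝔭 y∈𝔭

  Height≥-pred : ∀ {n 𝔭} → Height≥ (suc n) 𝔭 → Height≥ n 𝔭
  Height≥-pred {zero}  (h-suc 𝔮 𝔮⊂𝔭 h) = h-zero
  Height≥-pred {suc n} (h-suc 𝔮 𝔮⊂𝔭 h) = h-suc 𝔮 𝔮⊂𝔭 (Height≥-pred h)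

  Codim≥-pred : ∀ {n x} → Codim≥ (suc n) x → Codim≥ n x
  Codim≥-pred h 𝔭 x∈𝔭 = Height≥-pred (h 𝔭 x∈𝔭)

  truncation : ℕ → CoHeytingAlgebra c (lsuc (c ⊔ ℓ₁ ⊔ ℓ₂)) (lsuc (c ⊔ ℓ₁ ⊔ ℓ₂))
  truncation n = L /ᴵ codimIdeal n

  Hausdorff : Set (lsuc (c ⊔ ℓ₁ ⊔ ℓ₂))
  Hausdorff = ∀ x → ¬ (x ≈ ⊥) → FiniteCodim x

Finite : Setoid c ℓ₁ → Set (c ⊔ ℓ₁)
Finite S = ∃[ n ] Inverse (≡.setoid (Fin n)) S

Precompact : CoHeytingAlgebra c ℓ₁ ℓ₂ → Set (lsuc (c ⊔ ℓ₁ ⊔ ℓ₂))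
Precompact L = ∀ n .{{_ : NonZero n}} →
               Finite (CoHeytingAlgebra.setoid (truncation L n))

module _ (L : CoHeytingAlgebra c ℓ₁ ℓ₂) where
  private
    module L = CoHeytingAlgebra L
    module L/ (n : ℕ) = CoHeytingAlgebra (truncation L n)
    module L/-Join (n : ℕ) = JoinProperties (L/.joinSemilattice n)
    module Q (n : ℕ) = Quotient L (codimIdeal L n)

  -- All the L / nL share the carrier of L, so the canonical surjection
  -- L / (n+1)L → L / nL acts as the identity on representatives.
  record Thread : Set (lsuc (c ⊔ ℓ₁ ⊔ ℓ₂)) where
    field
      at       : ℕ → L.Carrier
      coherent : ∀ n → L/._≈_ n (at (suc n)) (at n)

  open Thread

  private
    weaken : ∀ {n x y} → L/._≤_ (suc n) x y → L/._≤_ n x y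
    weaken = Codim≥-pred L

    ≤-at : ∀ (x : Thread) n → L/._≤_ n (at x (suc n)) (at x n)
    ≤-at x n = L/.reflexive n (coherent x n)

    ≥-at : ∀ (x : Thread) n → L/._≤_ n (at x n) (at x (suc n))
    ≥-at x n = L/.reflexive n (L/.Eq.sym n (coherent x n))

    -‿mono : ∀ n {x x′ y y′} → L/._≤_ n x x′ → L/._≤_ n y′ y →
             L/._≤_ n (x L.- y) (x′ L.- y′)
    -‿mono n {x} {x′} {y} {y′} p q = L/.-least n
      (L/.trans n p (L/.trans n (L/.x≤y∨[x-y] n x′ y′)
        (L/-Join.∨-monotonic n q (L/.refl n))))

    pointwise : (L.Carrier → L.Carrier → L.Carrier) → Set (lsuc (c ⊔ ℓ₁ ⊔ ℓ₂))
    pointwise _∙_ = ∀ n {x x′ y y′} → L/._≈_ n x x′ → L/._≈_ n y y′ →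
                    L/._≈_ n (x ∙ y) (x′ ∙ y′)

    zipThread : (_∙_ : Op₂ L.Carrier) → pointwise _∙_ → Op₂ Thread
    zipThread _∙_ ∙-cong x y = record
      { at       = λ n → at x n ∙ at y n
      ; coherent = λ n → ∙-cong n (coherent x n) (coherent y n)
      }

    ∧-congᴵ : pointwise L._∧_
    ∧-congᴵ n p q = L/.antisym n (mono p q) (mono (L/.Eq.sym n p) (L/.Eq.sym n q))
      where
      mono : ∀ {x x′ y y′} → L/._≈_ n x x′ → L/._≈_ n y y′ →
             L/._≤_ n (x L.∧ y) (x′ L.∧ y′)
      mono {x} {y = y} p q = L/.∧-greatest n
        (L/.trans n (L/.x∧y≤x n x y) (L/.reflexive n p))
        (L/.trans n (L/.x∧y≤y n x y) (L/.reflexive n q))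

    -‿congᴵ : pointwise L._-_
    -‿congᴵ n p q = L/.antisym n
      (-‿mono n (L/.reflexive n p) (L/.reflexive n (L/.Eq.sym n q)))
      (-‿mono n (L/.reflexive n (L/.Eq.sym n p)) (L/.reflexive n q))

  diagonal : L.Carrier → Thread
  diagonal x = record { at = λ _ → x ; coherent = λ n → L/.Eq.refl n }

  projectiveLimit : CoHeytingAlgebra (lsuc (c ⊔ ℓ₁ ⊔ ℓ₂)) (lsuc (c ⊔ ℓ₁ ⊔ ℓ₂)) (lsuc (c ⊔ ℓ₁ ⊔ ℓ₂))
  projectiveLimit = record
    { Carrier = Thread
    ; _≈_ = λ x y → ∀ n → L/._≈_ n (at x n) (at y n)
    ; _≤_ = λ x y → ∀ n → L/._≤_ n (at x n) (at y n)
    ; _∨_ = zipThread L._∨_ (λ n → L/-Join.∨-cong n)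
    ; _∧_ = zipThread L._∧_ ∧-congᴵ
    ; _-_ = zipThread L._-_ -‿congᴵ
    ; ⊤ = diagonal L.⊤
    ; ⊥ = diagonal L.⊥
    ; isBoundedLattice = record
      { isLattice = record
        { isPartialOrder = record
          { isPreorder = record
            { isEquivalence = record
              { refl  = λ n → L/.Eq.refl n
              ; sym   = λ p n → L/.Eq.sym n (p n)
              ; trans = λ p q n → L/.Eq.trans n (p n) (q n)
              }
            ; reflexive = λ p n → L/.reflexive n (p n)
            ; trans     = λ p q n → L/.trans n (p n) (q n)
            }
          ; antisym = λ p q n → L/.antisym n (p n) (q n)
          }
        ; supremum = λ x y →
              (λ n → L/.x≤x∨y n (at x n) (at y n))
            , (λ n → L/.y≤x∨y n (at x n) (at y n))
            , (λ z p q n → L/.∨-least n (p n) (q n))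
        ; infimum  = λ x y →
              (λ n → L/.x∧y≤x n (at x n) (at y n))
            , (λ n → L/.x∧y≤y n (at x n) (at y n))
            , (λ z p q n → L/.∧-greatest n (p n) (q n))
        }
      ; maximum = λ x n → L/.maximum n (at x n)
      ; minimum = λ x n → L/.minimum n (at x n)
      }
    ; ∧-distribˡ-∨ = λ x y z n → L/.∧-distribˡ-∨ n (at x n) (at y n) (at z n)
    ; x≤y∨[x-y]    = λ x y n → L/.x≤y∨[x-y] n (at x n) (at y n)
    ; -least       = λ p n → L/.-least n (p n)
    }

-- U is open in the coarsest topology on A making every f i : A → Y i
-- continuous for the discrete topology on Y i: the finite intersections
-- of fibres of the f i are a base.
InitialOpen : {A : Set a} {I : Set i} (Y : I → Setoid c ℓ₁) →
              (∀ i → A → Setoid.Carrier (Y i)) → Pred (Pred A u) (a ⊔ i ⊔ ℓ₁ ⊔ u)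
InitialOpen {I = I} Y f U = ∀ x → x ∈ U → Σ[ is ∈ List I ]
  (∀ y → All (λ i → Setoid._≈_ (Y i) (f i y) (f i x)) is → y ∈ U)

MetricOpen : {A : Set a} → DistanceFunction A → Pred (Pred A u) (a ⊔ u)
MetricOpen dist U = ∀ x → x ∈ U → ∃[ ε ] 0ℚ ℚ.< ε × (∀ y → dist x y ℚ.< ε → y ∈ U)

Closure : {A : Set a} → Pred (Pred A u) o → Pred A s → Pred A (a ⊔ lsuc u ⊔ o ⊔ s)
Closure {u = u} {A = A} Open S x = (U : Pred A u) → Open U → x ∈ U → U ≬ S

Image : {A : Set a} (B : Setoid b ℓ₁) → (A → Setoid.Carrier B) →
        Pred A s → Pred (Setoid.Carrier B) (a ⊔ ℓ₁ ⊔ s)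
Image B f S y = ∃[ x ] x ∈ S × Setoid._≈_ B (f x) y

ProjectiveOpen : (L : CoHeytingAlgebra c ℓ₁ ℓ₂) →
                 Pred (Pred (Thread L) (lsuc (c ⊔ ℓ₁ ⊔ ℓ₂))) (lsuc (c ⊔ ℓ₁ ⊔ ℓ₂))
ProjectiveOpen L = InitialOpen
  (λ n → CoHeytingAlgebra.setoid (truncation L n)) (λ n x → Thread.at x n)

2^-_ : ℕ → ℚ
2^- n = _/_ (+ 1) (2 ℕ.^ n) {{m^n≢0 2 n}}

-- Excluded middle decides whether a codimension is finite.  The exponent
-- is then determined, since HasCodim n x holds for at most one n.
codimDist : ExcludedMiddle (lsuc (c ⊔ ℓ₁ ⊔ ℓ₂)) → (M : CoHeytingAlgebra c ℓ₁ ℓ₂) →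
            DistanceFunction (CoHeytingAlgebra.Carrier M)
codimDist lem M x y = fromDec lem
  where
  open CoHeytingAlgebra M
  fromDec : Dec (FiniteCodim M (x △ y)) → ℚ
  fromDec (yes (n , _)) = 2^- n
  fromDec (no _)        = 0ℚ

Cauchy : {A : Set a} → DistanceFunction A → Pred (ℕ → A) _
Cauchy dist x = ∀ ε → 0ℚ ℚ.< ε →
  ∃[ N ] (∀ m n → N ℕ.≤ m → N ℕ.≤ n → dist (x m) (x n) ℚ.< ε)

ConvergesTo : {A : Set a} → DistanceFunction A → (ℕ → A) → A → Set
ConvergesTo dist x l = ∀ ε → 0ℚ ℚ.< ε → ∃[ N ] (∀ n → N ℕ.≤ n → dist (x n) l ℚ.< ε)

record IsCompletion (A : Setoid a ℓ₁) (distᴬ : DistanceFunction (Setoid.Carrier A))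
                    (B : Setoid b ℓ₂) (distᴮ : DistanceFunction (Setoid.Carrier B))
                    (f : Setoid.Carrier A → Setoid.Carrier B)
                    : Set (a ⊔ b ⊔ ℓ₁ ⊔ ℓ₂) where
  private
    module A = Setoid A
    module B = Setoid B
  field
    isMetricᴬ : IsMetric A._≈_ distᴬ
    isMetricᴮ : IsMetric B._≈_ distᴮ
    isometric : ∀ x y → distᴮ (f x) (f y) ≡ distᴬ x y
    dense     : ∀ y ε → 0ℚ ℚ.< ε → ∃[ x ] distᴮ (f x) y ℚ.< ε
    complete  : ∀ (u : ℕ → B.Carrier) → Cauchy distᴮ u → ∃[ l ] ConvergesTo distᴮ u l

{-# OPTIONS --safe #-}
module Submission where

-- If L / nL is finite, its prime filters are those of L of height < n: such a
-- filter is generated by a join-prime j modulo nL, and j lies in some prime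
-- filter of height < n.  Hausdorffness then says that the prime filters of
-- finite height separate the elements of L, which replaces any appeal to
-- Zorn's lemma.  Let ε d represent the largest element of dL modulo (d+1)L.
-- Every prime filter of height exactly d meets dL, hence contains ε d, and every
-- prime filter of finite height ≥ d contains one of height exactly d; by
-- separation ε d generates dL.
--
-- The kernel K of L̂ → L / dL is generated by ι (ε d).  Prime filters of L of
-- height < d lift to prime filters of L̂ of the same height avoiding K, so dL̂ ⊆ K;
-- conversely any prime filter of L̂ that meets K contains the lift of a prime
-- filter of L of height ≥ d.  Hence K = dL̂.  Consequently dist (x , y) < 2⁻ⁿ says
-- that x and y have the same image in L / (n+1)L, and the topological claims follow.

open import Defs
open import Axiom.ExcludedMiddle using (ExcludedMiddle)
open import Data.Nat.Base using (ℕ; NonZero)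
open import Data.Product using (_×_; Σ-syntax)
open import Function.Bundles using (_⇔_)
open import Level using (_⊔_; suc)
open import Relation.Unary using (Pred; _≐_)

open import Data.Fin.Base as Fin using (Fin)
open import Data.Integer.Base as ℤ using (+_; +[1+_])
import Data.Integer.Properties as ℤ
open import Data.List.Base using ([]; _∷_)
open import Data.List.Extrema.Nat using (max; xs≤max; v≤max⁺)
open import Data.List.Relation.Unary.All as All using ([]; _∷_)
import Data.Nat.Base as ℕ
import Data.Nat.Properties as ℕ
open import Data.Product using (_,_; proj₁; proj₂; ∃-syntax)
open import Data.Rational.Base as ℚ using (ℚ; 0ℚ; mkℚ; toℚᵘ)
import Data.Rational.Properties as ℚ
open import Data.Rational.Unnormalised.Base as ℚᵘ using (mkℚᵘ)
import Data.Rational.Unnormalised.Properties as ℚᵘ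
open import Data.Sum.Base using (_⊎_; inj₁; inj₂; [_,_]′)
open import Function.Base using (_∘_; id; flip)
open import Function.Bundles using (Inverse; mk⇔)
open import Function.Metric.Rational.Core using (DistanceFunction)
open import Function.Metric.Rational.Structures using (IsMetric)
open import Level using (Level; Lift)
open import Relation.Binary.Core using (Rel)
open import Relation.Binary.Definitions using (Reflexive; Transitive)
import Relation.Binary.Lattice.Properties.JoinSemilattice as JoinProperties
open import Relation.Binary.PropositionalEquality.Core as ≡ using (_≡_)
open import Relation.Nullary.Decidable
  using (Dec; yes; no; True; toWitness; fromWitness; decidable-stable)
open import Relation.Nullary.Negation using (¬_; contradiction)
open import Relation.Unary using (_∈_; _∉_; _⊆_)

open PrimeFilter

private
  variable
    a c c′ ℓ ℓ₁ ℓ₁′ ℓ₂ ℓ₂′ p : Level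

-- Powers of two

toℚᵘ-1/ : ∀ n .{{_ : NonZero n}} → toℚᵘ (+ 1 ℚ./ n) ℚᵘ.≃ + 1 ℚᵘ./ n
toℚᵘ-1/ (ℕ.suc n) = ℚ.toℚᵘ-fromℚᵘ (mkℚᵘ (+ 1) n)

1/-anti : ∀ {m n} .{{_ : NonZero m}} .{{_ : NonZero n}} → m ℕ.< n → + 1 ℚ./ n ℚ.< + 1 ℚ./ m
1/-anti {m@(ℕ.suc _)} {n@(ℕ.suc _)} m<n = ℚ.toℚᵘ-cancel-<
  (ℚᵘ.<-respˡ-≃ (ℚᵘ.≃-sym (toℚᵘ-1/ n)) (ℚᵘ.<-respʳ-≃ (ℚᵘ.≃-sym (toℚᵘ-1/ m))
    (ℚᵘ.*<* (ℤ.*-monoˡ-<-pos (+ 1) (ℤ.+<+ m<n)))))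

2^-anti : ∀ {m n} → m ℕ.< n → 2^- n ℚ.< 2^- m
2^-anti {m} {n} m<n = 1/-anti {{ℕ.m^n≢0 2 m}} {{ℕ.m^n≢0 2 n}}
  (ℕ.^-monoʳ-< 2 (ℕ.s≤s (ℕ.s≤s ℕ.z≤n)) m<n)

0<2^- : ∀ n → 0ℚ ℚ.< 2^- n
0<2^- n = ℚ.positive⁻¹ (2^- n) {{ℚ.normalize-pos 1 (2 ℕ.^ n) {{ℕ.m^n≢0 2 n}}}}

n<2^n : ∀ n → n ℕ.< 2 ℕ.^ n
n<2^n ℕ.zero    = ℕ.s≤s ℕ.z≤n
n<2^n (ℕ.suc n) = ℕ.+-mono-≤ (ℕ.≤-trans (ℕ.s≤s ℕ.z≤n) (n<2^n n))
  (ℕ.≤-trans (n<2^n n) (ℕ.m≤m+n (2 ℕ.^ n) 0))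

-- A positive rational has numerator at least 1, so it is at least the reciprocal of its
-- denominator.
1/-small : ∀ {q n} .{{_ : NonZero n}} → 0ℚ ℚ.< q → ℚ.↧ₙ q ℕ.< n → + 1 ℚ./ n ℚ.< q
1/-small {mkℚ +[1+ k ] d _} {n@(ℕ.suc _)} _ d<n = ℚ.toℚᵘ-cancel-<
  (ℚᵘ.<-respˡ-≃ (ℚᵘ.≃-sym (toℚᵘ-1/ n))
    (ℚᵘ.*<* (ℤ.+<+ (ℕ.≤-trans (ℕ.s≤s (ℕ.≤-reflexive (ℕ.*-identityˡ (ℕ.suc d))))
      (ℕ.≤-trans d<n (ℕ.m≤m+n n (k ℕ.* n)))))))
1/-small {mkℚ (+ 0) _ _}        (ℚ.*<* (ℤ.+<+ ()))
1/-small {mkℚ (ℤ.-[1+_] _) _ _} (ℚ.*<* ())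

2^-small : ∀ {q} → 0ℚ ℚ.< q → ∃[ n ] 2^- n ℚ.< q
2^-small {q} 0<q = ℚ.↧ₙ q , 1/-small {{ℕ.m^n≢0 2 (ℚ.↧ₙ q)}} 0<q (n<2^n (ℚ.↧ₙ q))

2^-anti-≤ : ∀ {m n} → m ℕ.≤ n → 2^- n ℚ.≤ 2^- m
2^-anti-≤ {m} m≤n with ℕ.m≤n⇒m<n∨m≡n m≤n
... | inj₁ m<n    = ℚ.<⇒≤ (2^-anti m<n)
... | inj₂ ≡.refl = ℚ.≤-refl {2^- m}

-- Prime filters of finite height

module _ (M : CoHeytingAlgebra c ℓ₁ ℓ₂) where
  open CoHeytingAlgebra M

  -- Only the top link of the chain changes: whatever is strictly below `𝔭` is strictly below every
  -- larger `𝔮`.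
  Height≥-mono : ∀ {n 𝔭 𝔮} → filter 𝔭 ⊆ filter 𝔮 → Height≥ M n 𝔭 → Height≥ M n 𝔮
  Height≥-mono 𝔭⊆𝔮 h-zero = h-zero
  Height≥-mono 𝔭⊆𝔮 (h-suc 𝔯 (𝔯⊆𝔭 , 𝔭⊈𝔯) h) =
    h-suc 𝔯 ((λ x∈𝔯 → 𝔭⊆𝔮 (𝔯⊆𝔭 x∈𝔯)) , (λ 𝔮⊆𝔯 → 𝔭⊈𝔯 (λ x∈𝔭 → 𝔮⊆𝔯 (𝔭⊆𝔮 x∈𝔭)))) h

  Codim≥-anti : ∀ {m n} → m ℕ.≤ n → Codim≥ M n ⊆ Codim≥ M m
  Codim≥-anti ℕ.z≤n       _ _ _   = h-zero
  Codim≥-anti (ℕ.s≤s m≤n) h 𝔭 x∈𝔭 = Height≥-anti (ℕ.s≤s m≤n) (h 𝔭 x∈𝔭)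
    where
    Height≥-anti : ∀ {m n 𝔭} → m ℕ.≤ n → Height≥ M n 𝔭 → Height≥ M m 𝔭
    Height≥-anti ℕ.z≤n       _                = h-zero
    Height≥-anti (ℕ.s≤s m≤n) (h-suc 𝔮 𝔮⊂𝔭 h) = h-suc 𝔮 𝔮⊂𝔭 (Height≥-anti m≤n h)

-- Bounds for finite families

abstract
  -- Excluded middle decides which `f i` lie in `P`, and those are combined by `_∙_`. Reversing the
  -- order gives upper bounds in an ideal.
  finite-bound : (∀ {ℓ} → ExcludedMiddle ℓ) → {A : Set a} {_≼_ : Rel A ℓ} →
                 Reflexive _≼_ → Transitive _≼_ → (_∙_ : A → A → A) →
                 (∀ x y → (x ∙ y) ≼ x) → (∀ x y → (x ∙ y) ≼ y) →
                 {P : Pred A p} → (∀ {x y} → x ∈ P → y ∈ P → x ∙ y ∈ P) → ∃[ u ] u ∈ P →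
                 ∀ {n} (f : Fin n → A) → ∃[ g ] g ∈ P × (∀ i → f i ∈ P → g ≼ f i)
  finite-bound lem {_≼_ = _≼_} ≼-refl ≼-trans _∙_ ∙-lowerˡ ∙-lowerʳ {P} ∙-closed (u , u∈P) = go
    where
    go : ∀ {n} (f : Fin n → _) → ∃[ g ] g ∈ P × (∀ i → f i ∈ P → g ≼ f i)
    go {ℕ.zero}  f = u , u∈P , λ ()
    go {ℕ.suc n} f with go (f ∘ Fin.suc) | lem {P = f Fin.zero ∈ P}
    ... | g , g∈P , g≼ | yes f0∈P = g ∙ f Fin.zero , ∙-closed g∈P f0∈P , λ where
      Fin.zero    _    → ∙-lowerʳ g (f Fin.zero)
      (Fin.suc i) fi∈P → ≼-trans (∙-lowerˡ g (f Fin.zero)) (g≼ i fi∈P)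
    ... | g , g∈P , g≼ | no f0∉P = g , g∈P , λ where
      Fin.zero    f0∈P → contradiction f0∈P f0∉P
      (Fin.suc i) fi∈P → g≼ i fi∈P

-- Homomorphisms and induced maps of quotients

record IsCoHeytingHomomorphism
  (L : CoHeytingAlgebra c ℓ₁ ℓ₂) (M : CoHeytingAlgebra c′ ℓ₁′ ℓ₂′)
  (f : CoHeytingAlgebra.Carrier L → CoHeytingAlgebra.Carrier M) : Set (c ⊔ ℓ₁′) where
  private
    module L = CoHeytingAlgebra L
    module M = CoHeytingAlgebra M
  field
    ∨-homo : ∀ x y → f (x L.∨ y) M.≈ f x M.∨ f y
    ∧-homo : ∀ x y → f (x L.∧ y) M.≈ f x M.∧ f y
    -‿homo : ∀ x y → f (x L.- y) M.≈ f x M.- f y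
    ⊤-homo : f L.⊤ M.≈ M.⊤
    ⊥-homo : f L.⊥ M.≈ M.⊥

module _ {L : CoHeytingAlgebra c ℓ₁ ℓ₂} {M : CoHeytingAlgebra c′ ℓ₁′ ℓ₂′}
         {f : CoHeytingAlgebra.Carrier L → CoHeytingAlgebra.Carrier M}
         (hom : IsCoHeytingHomomorphism L M f) {i j : Level} (I : Ideal L i) (J : Ideal M j) where
  private
    module L = CoHeytingAlgebra L
    module M = CoHeytingAlgebra M
    module M/J = Quotient M J
  open IsCoHeytingHomomorphism hom

  △-homo : ∀ x y → f (x L.△ y) M.≈ f x M.△ f y
  △-homo x y = M.Eq.trans (∨-homo _ _) (∨-cong (-‿homo x y) (-‿homo y x))
    where open JoinProperties M.joinSemilattice using (∨-cong)

  -- The hypothesis of surjectivity does not use M._△_: for M = L̂ the two spellings agree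
  -- only after an expensive unfolding of coherence proofs.
  quotient-isomorphism :
    (∀ {x} → x ∈ member I → f x ∈ member J) → (∀ {x} → f x ∈ member J → x ∈ member I) →
    (∀ y → ∃[ x ] CoHeytingAlgebra._△_ M (f x) y ∈ member J) →
    IsCoHeytingIsomorphism (L /ᴵ I) (M /ᴵ J) f
  quotient-isomorphism I⇒J J⇒I surjective = record
    { cong       = cong
    ; injective  = λ fx≡fy → J⇒I (Ideal.↓-closed J (M.reflexive (△-homo _ _)) fx≡fy)
    ; surjective = λ y → proj₁ (surjective y) , λ z≡x →
        M/J.≡ᴵ-trans (cong z≡x) (proj₂ (surjective y))
    ; ∨-homo     = λ x y → M/J.≈⇒≡ᴵ (∨-homo x y)
    ; ∧-homo     = λ x y → M/J.≈⇒≡ᴵ (∧-homo x y)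
    ; -‿homo     = λ x y → M/J.≈⇒≡ᴵ (-‿homo x y)
    ; ⊤-homo     = M/J.≈⇒≡ᴵ ⊤-homo
    ; ⊥-homo     = M/J.≈⇒≡ᴵ ⊥-homo
    }
    where
    cong : ∀ {x y} → x L.△ y ∈ member I → f x M.△ f y ∈ member J
    cong x≡y = Ideal.↓-closed J (M.reflexive (M.Eq.sym (△-homo _ _))) (I⇒J x≡y)

diagonal-isHomomorphism : (L : CoHeytingAlgebra c ℓ₁ ℓ₂) →
                          IsCoHeytingHomomorphism L (projectiveLimit L) (diagonal L)
diagonal-isHomomorphism L = record
  { ∨-homo = λ x y n → refl n
  ; ∧-homo = λ x y n → refl n
  ; -‿homo = λ x y n → refl n
  ; ⊤-homo = λ n → refl n
  ; ⊥-homo = λ n → refl n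
  }
  where
  refl : ∀ n {x} → CoHeytingAlgebra._≈_ (truncation L n) x x
  refl n = CoHeytingAlgebra.Eq.refl (truncation L n)

-- Prime filters from finite quotients

module Classical (lem : ∀ {ℓ} → ExcludedMiddle ℓ) where

  by-contradiction : {P : Set p} → ¬ ¬ P → P
  by-contradiction = decidable-stable lem

  module _ {c ℓ₁ ℓ₂ : Level} (M : CoHeytingAlgebra c ℓ₁ ℓ₂) where
    open CoHeytingAlgebra M

    -- Excluded middle resizes propositions, so a prime filter may be given by
    -- a predicate of any level.
    abstract
      primeFilter : (P : Pred Carrier p) →
                    ⊤ ∈ P → (∀ {x y} → x ∈ P → y ∈ P → x ∧ y ∈ P) →
                    (∀ {x y} → x ≤ y → x ∈ P → y ∈ P) → ⊥ ∉ P →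
                    (∀ {x y} → x ∨ y ∈ P → x ∈ P ⊎ y ∈ P) →
                    Σ[ 𝔭 ∈ PrimeFilter M ] filter 𝔭 ≐ P
      primeFilter P ⊤∈ ∧∈ ↑∈ ⊥∉ ∨∈ = record
        { filter   = Resized
        ; ⊤-closed = into ⊤∈
        ; ∧-closed = λ x∈ y∈ → into (∧∈ (out x∈) (out y∈))
        ; ↑-closed = λ x≤y x∈ → into (↑∈ x≤y (out x∈))
        ; proper   = λ ⊥∈ → ⊥∉ (out ⊥∈)
        ; prime    = λ x∨y∈ → [ inj₁ ∘ into , inj₂ ∘ into ]′ (∨∈ (out x∨y∈))
        } , out , into
        where
        Resized : Pred Carrier (c ⊔ ℓ₁ ⊔ ℓ₂)
        Resized x = Lift _ (True (lem {P = P x}))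

        into : P ⊆ Resized
        into x∈P = Level.lift (fromWitness x∈P)

        out : Resized ⊆ P
        out (Level.lift x∈P) = toWitness x∈P

  module _ (D : CoHeytingAlgebra c ℓ₁ ℓ₂) where
    open CoHeytingAlgebra D

    -- j is a, met with each f i in turn unless that would bring it below b.
    finite-split : ∀ {a b} → ¬ a ≤ b → ∀ {n} (f : Fin n → Carrier) →
                   ∃[ j ] j ≤ a × ¬ j ≤ b × (∀ i → j ≤ f i ⊎ j ∧ f i ≤ b)
    finite-split a≰b {ℕ.zero} f = _ , refl , a≰b , λ ()
    finite-split {b = b} a≰b {ℕ.suc n} f with finite-split a≰b (f ∘ Fin.suc)
    ... | j , j≤a , j≰b , split with lem {P = j ∧ f Fin.zero ≤ b}
    ... | yes jf≤b = j , j≤a , j≰b , λ where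
      Fin.zero    → inj₂ jf≤b
      (Fin.suc i) → split i
    ... | no jf≰b = j ∧ f Fin.zero , trans (x∧y≤x _ _) j≤a , jf≰b , λ where
      Fin.zero    → inj₁ (x∧y≤y _ _)
      (Fin.suc i) → [ inj₁ ∘ trans (x∧y≤x _ _)
                    , inj₂ ∘ trans (∧-greatest (trans (x∧y≤x _ _) (x∧y≤x _ _)) (x∧y≤y _ _))
                    ]′ (split i)

    abstract
      -- Run `finite-split` over an enumeration of the whole algebra. If `j ≤ x ∨ y` while `j ∧ x`
      -- and `j ∧ y` are both below `b`, distributivity puts `j` below `b`, which is excluded.
      join-prime-below : Finite setoid → ∀ {a b} → ¬ a ≤ b →
                         ∃[ j ] j ≤ a × ¬ j ≤ b × (∀ {x y} → j ≤ x ∨ y → j ≤ x ⊎ j ≤ y)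
      join-prime-below (n , inv) {a} {b} a≰b with finite-split a≰b (Inverse.to inv)
      ... | j , j≤a , j≰b , split =
        j , j≤a , j≰b , λ {x} {y} j≤x∨y → decide j≤x∨y (split′ x) (split′ y)
        where
        split′ : ∀ x → j ≤ x ⊎ j ∧ x ≤ b
        split′ x = [ (λ j≤fi → inj₁ (trans j≤fi (reflexive fi≈x)))
                   , (λ jfi≤b → inj₂ (trans (∧-greatest (x∧y≤x _ _)
                                       (trans (x∧y≤y _ _) (reflexive (Eq.sym fi≈x)))) jfi≤b))
                   ]′ (split (Inverse.from inv x))
          where
          fi≈x : Inverse.to inv (Inverse.from inv x) ≈ x
          fi≈x = Inverse.strictlyInverseˡ inv x

        decide : ∀ {x y} → j ≤ x ∨ y → j ≤ x ⊎ j ∧ x ≤ b → j ≤ y ⊎ j ∧ y ≤ b → j ≤ x ⊎ j ≤ y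
        decide _     (inj₁ j≤x)  _           = inj₁ j≤x
        decide _     (inj₂ _)    (inj₁ j≤y)  = inj₂ j≤y
        decide j≤x∨y (inj₂ jx≤b) (inj₂ jy≤b) = contradiction
          (trans (∧-greatest refl j≤x∨y)
            (trans (reflexive (∧-distribˡ-∨ _ _ _)) (∨-least jx≤b jy≤b))) j≰b

  module PrimeFilters (L : CoHeytingAlgebra c ℓ₁ ℓ₂) where
    open CoHeytingAlgebra L

    infix 4 _≤[_]_

    _≤[_]_ : Carrier → ℕ → Carrier → Set _
    x ≤[ n ] y = CoHeytingAlgebra._≤_ (truncation L n) x y

    -- A prime filter of height below `n` misses nL, so it is the preimage of a prime filter of L /
    -- nL.
    ≤[]-closed : ∀ {n 𝔭 x y} → ¬ Height≥ L n 𝔭 → x ≤[ n ] y → x ∈ filter 𝔭 → y ∈ filter 𝔭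
    ≤[]-closed {𝔭 = 𝔭} {x} {y} 𝔭-low x≤y x∈𝔭 =
      [ id , (λ x-y∈𝔭 → contradiction (x≤y 𝔭 x-y∈𝔭) 𝔭-low) ]′
        (prime 𝔭 (↑-closed 𝔭 (x≤y∨[x-y] x y) x∈𝔭))

    ¬Codim≥⇒prime : ∀ {n x} → ¬ Codim≥ L n x → ∃[ 𝔭 ] x ∈ filter 𝔭 × ¬ Height≥ L n 𝔭
    ¬Codim≥⇒prime ¬h = by-contradiction λ ¬∃ → ¬h λ 𝔭 x∈𝔭 →
      by-contradiction λ ¬ht → ¬∃ (𝔭 , x∈𝔭 , ¬ht)

    Codim≥⇒≤[] : ∀ {n x y} → Codim≥ L n x → x ≤[ n ] y
    Codim≥⇒≤[] {n} = Ideal.↓-closed (codimIdeal L n) (-least (y≤x∨y _ _))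

    Codim≥-≤[]-closed : ∀ {n x y} → x ≤[ n ] y → Codim≥ L n y → Codim≥ L n x
    Codim≥-≤[]-closed {n} {x} {y} x≤y y-high =
      ↓-closed (x≤y∨[x-y] x y) (∨-closed y-high x≤y)
      where open Ideal (codimIdeal L n)

    ≤⇒≤[] : ∀ {n x y} → x ≤ y → x ≤[ n ] y
    ≤⇒≤[] {n} = Quotient.≤⇒≤ᴵ L (codimIdeal L n)

    abstract
      -- `m` bounds the height and drops by one with each step to a smaller prime filter, so the
      -- descent reaches a filter whose height is not at least d + 1.
      height-descent : ∀ m {d 𝔭} → ¬ Height≥ L m 𝔭 → Height≥ L d 𝔭 →
                       ∃[ 𝔮 ] filter 𝔮 ⊆ filter 𝔭 × HasHeight L d 𝔮
      height-descent ℕ.zero    ¬h _ = contradiction h-zero ¬h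
      height-descent (ℕ.suc m) {d} {𝔭} ¬h h with lem {P = Height≥ L (ℕ.suc d) 𝔭}
      ... | no ¬h′ = 𝔭 , id , h , ¬h′
      ... | yes (h-suc 𝔮 𝔮⊂𝔭 h′) =
        let 𝔯 , 𝔯⊆𝔮 , hasHeight = height-descent m (¬h ∘ h-suc 𝔮 𝔮⊂𝔭) h′
        in  𝔯 , (λ x∈𝔯 → proj₁ 𝔮⊂𝔭 (𝔯⊆𝔮 x∈𝔯)) , hasHeight

    truncation-separates : ∀ {n a b} → Finite (CoHeytingAlgebra.setoid (truncation L n)) →
                           ¬ a ≤[ n ] b →
                           ∃[ 𝔭 ] a ∈ filter 𝔭 × b ∉ filter 𝔭 × ¬ Height≥ L n 𝔭
    truncation-separates {n} {a} {b} fin a≰b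
      with join-prime-below (truncation L n) fin a≰b
    ... | j , j≤a , j≰b , j-prime = 𝔭 , into j≤a , (λ b∈𝔭 → j≰b (out b∈𝔭)) , low
      where
      module D = CoHeytingAlgebra (truncation L n)

      principal : Σ[ 𝔭 ∈ PrimeFilter L ] filter 𝔭 ≐ (j ≤[ n ]_)
      principal = primeFilter L (j ≤[ n ]_) (D.maximum j) D.∧-greatest
        (λ x≤y j≤x → D.trans j≤x (≤⇒≤[] x≤y))
        (λ j≤⊥ → j≰b (D.trans j≤⊥ (D.minimum b)))
        j-prime

      𝔭 = proj₁ principal
      out = proj₁ (proj₂ principal)
      into = proj₂ (proj₂ principal)

      low : ¬ Height≥ L n 𝔭
      -- `j` is nonzero modulo nL, so it lies in a prime filter `𝔮` of height below `n`. Being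
      -- closed upwards modulo nL, `𝔮` contains `𝔭`.
      low h with ¬Codim≥⇒prime (λ j-high → j≰b (Codim≥⇒≤[] j-high))
      ... | 𝔮 , j∈𝔮 , 𝔮-low =
        𝔮-low (Height≥-mono L (λ x∈𝔭 → ≤[]-closed 𝔮-low (out x∈𝔭) j∈𝔮) h)

  -- The codimetric distance

  module _ (M : CoHeytingAlgebra c ℓ₁ ℓ₂) where
    open CoHeytingAlgebra M

    HasCodim⇒¬Codim≥ : ∀ {n x} → HasCodim M n x → ¬ Codim≥ M (ℕ.suc n) x
    HasCodim⇒¬Codim≥ ((𝔭 , x∈𝔭 , _ , 𝔭-low) , _) x-high = 𝔭-low (x-high 𝔭 x∈𝔭)

    -- At the first `n` where codimension n + 1 fails, the offending prime filter has height exactly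
    -- `n`, which makes the codimension finite.
    ¬FiniteCodim⇒Codim≥ : ∀ {x} → ¬ FiniteCodim M x → ∀ n → Codim≥ M n x
    ¬FiniteCodim⇒Codim≥ ¬fin ℕ.zero    𝔭 _ = h-zero
    ¬FiniteCodim⇒Codim≥ ¬fin (ℕ.suc n) = by-contradiction λ ¬high →
      let 𝔭 , x∈𝔭 , 𝔭-low = PrimeFilters.¬Codim≥⇒prime M ¬high
          high = ¬FiniteCodim⇒Codim≥ ¬fin n
      in  ¬fin (n , (𝔭 , x∈𝔭 , high 𝔭 x∈𝔭 , 𝔭-low) , high)

    dist : Carrier → Carrier → ℚ
    dist = codimDist lem M

    -- Hides the decision inside `codimDist`, so that later proofs only compare codimensions.
    dist-cases : ∀ x y → (∃[ n ] HasCodim M n (x △ y) × dist x y ≡ 2^- n)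
                       ⊎ ((∀ n → Codim≥ M n (x △ y)) × dist x y ≡ 0ℚ)
    dist-cases x y with lem {P = FiniteCodim M (x △ y)}
    ... | yes (n , hasCodim) = inj₁ (n , hasCodim , ≡.refl)
    ... | no ¬fin            = inj₂ (¬FiniteCodim⇒Codim≥ ¬fin , ≡.refl)

    dist-nonNegative : ∀ x y → 0ℚ ℚ.≤ dist x y
    dist-nonNegative x y with dist-cases x y
    ... | inj₁ (n , _ , d≡) = ℚ.≤-trans (ℚ.<⇒≤ (0<2^- n)) (ℚ.≤-reflexive (≡.sym d≡))
    ... | inj₂ (_ , d≡)     = ℚ.≤-reflexive (≡.sym d≡)

    -- Nonzero distances are powers `2^- m`, and such a power is strictly below `2^- n` only for m ≥
    -- n + 1; hence the successor here and in the converse.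
    Codim≥⇒dist< : ∀ {n x y} → Codim≥ M (ℕ.suc n) (x △ y) → dist x y ℚ.< 2^- n
    Codim≥⇒dist< {n} {x} {y} high with dist-cases x y
    ... | inj₂ (_ , d≡) = ℚ.≤-<-trans (ℚ.≤-reflexive d≡) (0<2^- n)
    ... | inj₁ (m , hasCodim , d≡) = ℚ.≤-<-trans (ℚ.≤-reflexive d≡) (2^-anti (ℕ.≰⇒> λ m≤n →
      HasCodim⇒¬Codim≥ hasCodim (Codim≥-anti M (ℕ.s≤s m≤n) high)))

    dist<⇒Codim≥ : ∀ {n x y} → dist x y ℚ.< 2^- n → Codim≥ M (ℕ.suc n) (x △ y)
    dist<⇒Codim≥ {n} {x} {y} d<2^-n with dist-cases x y
    ... | inj₂ (high , _) = high (ℕ.suc n)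
    ... | inj₁ (m , (_ , high) , d≡) = Codim≥-anti M (ℕ.≰⇒> λ m≤n →
      ℚ.<-irrefl ≡.refl (ℚ.<-≤-trans d<2^-n
        (ℚ.≤-trans (2^-anti-≤ m≤n) (ℚ.≤-reflexive (≡.sym d≡))))) high

  -- With two algebras, one lemma serves symmetry and congruence within an algebra and, applied both
  -- ways between L and L̂, the isometry.
  dist-mono : (M : CoHeytingAlgebra c ℓ₁ ℓ₂) (M′ : CoHeytingAlgebra c′ ℓ₁′ ℓ₂′) → ∀ {x y x′ y′} →
              (∀ n → Codim≥ M n (CoHeytingAlgebra._△_ M x y) →
                     Codim≥ M′ n (CoHeytingAlgebra._△_ M′ x′ y′)) →
              dist M′ x′ y′ ℚ.≤ dist M x y
  dist-mono M M′ {x} {y} {x′} {y′} high⇒high with dist-cases M′ x′ y′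
  ... | inj₂ (_ , d≡)            = ℚ.≤-trans (ℚ.≤-reflexive d≡) (dist-nonNegative M x y)
  ... | inj₁ (n , hasCodim , d≡) = ℚ.≤-trans (ℚ.≤-reflexive d≡) (ℚ.≮⇒≥ λ d<2^-n →
    HasCodim⇒¬Codim≥ M′ hasCodim (high⇒high (ℕ.suc n) (dist<⇒Codim≥ M d<2^-n)))

  module _ (M : CoHeytingAlgebra c ℓ₁ ℓ₂) where
    open CoHeytingAlgebra M
    private module Q (n : ℕ) = Quotient M (codimIdeal M n)

    -- The distance is ultrametric: if both terms on the right were below `2^- n`, transitivity of
    -- congruence modulo (n+1)M would contradict the codimension of `x △ z`.
    dist-triangle : ∀ x y z → dist M x z ℚ.≤ dist M x y ℚ.+ dist M y z
    dist-triangle x y z with dist-cases M x z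
    ... | inj₂ (_ , d≡) = ℚ.≤-trans (ℚ.≤-reflexive d≡)
      (ℚ.+-mono-≤ (dist-nonNegative M x y) (dist-nonNegative M y z))
    ... | inj₁ (n , hasCodim , d≡) = ℚ.≤-trans (ℚ.≤-reflexive d≡) (either lem lem)
      where
      either : Dec (dist M x y ℚ.< 2^- n) → Dec (dist M y z ℚ.< 2^- n) →
               2^- n ℚ.≤ dist M x y ℚ.+ dist M y z
      either (no xy≮) _        = ℚ.≤-trans (ℚ.≤-reflexive (≡.sym (ℚ.+-identityʳ (2^- n))))
        (ℚ.+-mono-≤ (ℚ.≮⇒≥ xy≮) (dist-nonNegative M y z))
      either (yes _) (no yz≮)  = ℚ.≤-trans (ℚ.≤-reflexive (≡.sym (ℚ.+-identityˡ (2^- n))))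
        (ℚ.+-mono-≤ (dist-nonNegative M x y) (ℚ.≮⇒≥ yz≮))
      either (yes xy<) (yes yz<) = contradiction
        (Q.≡ᴵ-trans (ℕ.suc n) (dist<⇒Codim≥ M xy<) (dist<⇒Codim≥ M yz<))
        (HasCodim⇒¬Codim≥ M hasCodim)

    dist-isMetric : (∀ {x y} → (∀ n → Codim≥ M n (x △ y)) → x ≈ y) → IsMetric _≈_ (dist M)
    dist-isMetric separated = record
      { isSemiMetric = record
        { isQuasiSemiMetric = record
          { isPreMetric = record
            { isProtoMetric = record
              { isPartialOrder  = ℚ.≤-isPartialOrder
              ; ≈-isEquivalence = isEquivalence
              ; cong            = λ x≈x′ y≈y′ → ℚ.≤-antisym
                  (≤-cong (Eq.sym x≈x′) (Eq.sym y≈y′)) (≤-cong x≈x′ y≈y′)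
              ; nonNegative     = λ {x} {y} → dist-nonNegative M x y
              }
            ; ≈⇒0 = ≈⇒0
            }
          ; 0⇒≈ = 0⇒≈
          }
        ; sym = λ x y → ℚ.≤-antisym (≤-sym y x) (≤-sym x y)
        }
      ; triangle = dist-triangle
      }
      where
      ≤-cong : ∀ {x y x′ y′} → x ≈ x′ → y ≈ y′ → dist M x′ y′ ℚ.≤ dist M x y
      ≤-cong x≈x′ y≈y′ = dist-mono M M λ n x≡y → Q.≡ᴵ-trans n (Q.≈⇒≡ᴵ n (Eq.sym x≈x′))
        (Q.≡ᴵ-trans n x≡y (Q.≈⇒≡ᴵ n y≈y′))

      ≤-sym : ∀ x y → dist M y x ℚ.≤ dist M x y
      ≤-sym x y = dist-mono M M λ n → Q.≡ᴵ-sym n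

      ≈⇒0 : ∀ {x y} → x ≈ y → dist M x y ≡ 0ℚ
      ≈⇒0 {x} {y} x≈y with dist-cases M x y
      ... | inj₂ (_ , d≡)           = d≡
      ... | inj₁ (n , hasCodim , _) =
        contradiction (Q.≈⇒≡ᴵ (ℕ.suc n) x≈y) (HasCodim⇒¬Codim≥ M hasCodim)

      0⇒≈ : ∀ {x y} → dist M x y ≡ 0ℚ → x ≈ y
      0⇒≈ {x} {y} d≡0 = separated λ n →
        Codim≥-anti M (ℕ.n≤1+n n) (dist<⇒Codim≥ M (ℚ.≤-<-trans (ℚ.≤-reflexive d≡0) (0<2^- n)))

  -- Generators of the codimension ideals

  module Completion (L : CoHeytingAlgebra c ℓ₁ ℓ₂) (hausdorff : Hausdorff L)
                    (precompact : Precompact L) where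
    open CoHeytingAlgebra L
    open PrimeFilters L
    open JoinProperties joinSemilattice using (∨-comm; ∨-monotonic)

    abstract
      -- By Hausdorffness `a - b` has some codimension m, so `a ≤ b` already fails in the finite
      -- quotient L / (m+1)L.
      separates : ∀ {a b} → ¬ a ≤ b →
                  ∃[ n ] ∃[ 𝔭 ] a ∈ filter 𝔭 × b ∉ filter 𝔭 × ¬ Height≥ L n 𝔭
      separates {a} {b} a≰b = let m , (𝔮 , a-b∈𝔮 , _ , 𝔮-low) , _ = hausdorff (a - b) a-b≉⊥ in
        ℕ.suc m , truncation-separates (precompact (ℕ.suc m)) λ a≤b → 𝔮-low (a≤b 𝔮 a-b∈𝔮)
        where
        a-b≉⊥ : ¬ a - b ≈ ⊥
        a-b≉⊥ a-b≈⊥ =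
          a≰b (trans (x≤y∨[x-y] a b) (∨-least refl (trans (reflexive a-b≈⊥) (minimum b))))

    -- The index is shifted by one because precompactness concerns positive levels only.
    representative : ∀ n → Fin (proj₁ (precompact (ℕ.suc n))) → Carrier
    representative n = Inverse.to (proj₂ (precompact (ℕ.suc n)))

    represents : ∀ n x → ∃[ i ] x ≤[ ℕ.suc n ] representative n i
                              × representative n i ≤[ ℕ.suc n ] x
    represents n x = Inverse.from fin x , D.reflexive (D.Eq.sym eq) , D.reflexive eq
      where
      module D = CoHeytingAlgebra (truncation L (ℕ.suc n))
      fin = proj₂ (precompact (ℕ.suc n))
      eq = Inverse.strictlyInverseˡ fin x

    abstract
      -- `j` is a lower bound in `𝔮` of the representatives modulo (d+1)L that lie in `𝔮`. A prime
      -- filter containing `j` either has height at least d + 1, or is closed under congruence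
      -- modulo (d+1)L and then contains `𝔮`.
      HasHeight⇒meets-codimIdeal : ∀ {d 𝔮} → HasHeight L d 𝔮 → ∃[ j ] j ∈ filter 𝔮 × Codim≥ L d j
      HasHeight⇒meets-codimIdeal {d} {𝔮} (h , 𝔮-low)
        with finite-bound lem refl trans _∧_ x∧y≤x x∧y≤y (∧-closed 𝔮) (⊤ , ⊤-closed 𝔮)
               (representative d)
      ... | j , j∈𝔮 , j≤ = j , j∈𝔮 , λ 𝔯 j∈𝔯 → high 𝔯 j∈𝔯 lem
        where
        high : ∀ 𝔯 → j ∈ filter 𝔯 → Dec (Height≥ L (ℕ.suc d) 𝔯) → Height≥ L d 𝔯
        high 𝔯 j∈𝔯 (yes h′)    = Height≥-pred L h′
        high 𝔯 j∈𝔯 (no 𝔯-low) = Height≥-mono L 𝔮⊆𝔯 h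
          where
          𝔮⊆𝔯 : filter 𝔮 ⊆ filter 𝔯
          𝔮⊆𝔯 {x} x∈𝔮 with represents d x
          ... | i , x≤i , i≤x = ≤[]-closed 𝔯-low i≤x
            (↑-closed 𝔯 (j≤ i (≤[]-closed 𝔮-low x≤i x∈𝔮)) j∈𝔯)

    abstract
      -- `P` is the preimage of an ideal of the finite lattice L / (d+1)L, and `g` represents the
      -- generator of that ideal.
      Codim≥-bound : ∀ {p} d {P : Pred Carrier p} →
                     (∀ {x y} → x ∈ P → y ∈ P → x ∨ y ∈ P) → ⊥ ∈ P →
                     (∀ {x y} → x ≤[ ℕ.suc d ] y → y ∈ P → x ∈ P) →
                     ∃[ g ] g ∈ P × (∀ {x} → x ∈ P → x ≤[ ℕ.suc d ] g)
      Codim≥-bound d {P} ∨∈ ⊥∈ ↓∈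
        with finite-bound lem {_≼_ = flip _≤_} refl (flip trans) _∨_ x≤x∨y y≤x∨y ∨∈ (⊥ , ⊥∈)
               (representative d)
      ... | g , g∈P , ≤g = g , g∈P , bound
        where
        bound : ∀ {x} → x ∈ P → x ≤[ ℕ.suc d ] g
        bound {x} x∈P with represents d x
        ... | i , x≤i , i≤x = CoHeytingAlgebra.trans (truncation L (ℕ.suc d)) x≤i
          (≤⇒≤[] (≤g i (↓∈ i≤x x∈P)))

    -- A prime filter separating `a` from `b` would have finite height, at least `d` because it
    -- contains `a`; so it would contain one of height exactly `d`, and with it `b`.
    ≤-by-height : ∀ {d a b} → Codim≥ L d a → (∀ 𝔮 → HasHeight L d 𝔮 → b ∈ filter 𝔮) → a ≤ b
    ≤-by-height {d} {a} {b} a-high b∈ = by-contradiction contra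
      where
      contra : ¬ ¬ a ≤ b
      contra a≰b with separates a≰b
      ... | _ , 𝔭 , a∈𝔭 , b∉𝔭 , 𝔭-low with height-descent _ 𝔭-low (a-high 𝔭 a∈𝔭)
      ... | 𝔮 , 𝔮⊆𝔭 , hasHeight = b∉𝔭 (𝔮⊆𝔭 (b∈ 𝔮 hasHeight))

    abstract
      codim-generator : ∀ d → ∃[ e ] Codim≥ L d e × (∀ {x} → Codim≥ L d x → x ≤ e)
      codim-generator d
        with Codim≥-bound d (Ideal.∨-closed (codimIdeal L d)) (Ideal.⊥-closed (codimIdeal L d))
               -- (d+1)L is contained in dL, so dL is downward closed modulo (d+1)L.
               (λ x≤y → Codim≥-≤[]-closed (Codim≥-pred L x≤y))
      ... | e , e-high , ≤e = e , e-high , λ x-high → ≤-by-height x-high e∈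
        where
        e∈ : ∀ 𝔮 → HasHeight L d 𝔮 → e ∈ filter 𝔮
        e∈ 𝔮 hasHeight with HasHeight⇒meets-codimIdeal hasHeight
        ... | j , j∈𝔮 , j-high = ≤[]-closed (proj₂ hasHeight) (≤e j-high) j∈𝔮

    ε : ℕ → Carrier
    ε d = proj₁ (codim-generator d)

    ε-high : ∀ d → Codim≥ L d (ε d)
    ε-high d = proj₁ (proj₂ (codim-generator d))

    Codim≥⇒≤ε : ∀ {d x} → Codim≥ L d x → x ≤ ε d
    Codim≥⇒≤ε {d} = proj₂ (proj₂ (codim-generator d))

    -- A prime filter of height exactly d contains ε d but not ε (d + 1).
    ε-difference : ∀ d → ε d ≤ ε d - ε (ℕ.suc d)
    ε-difference d = ≤-by-height (ε-high d) δ∈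
      where
      δ∈ : ∀ 𝔮 → HasHeight L d 𝔮 → (ε d - ε (ℕ.suc d)) ∈ filter 𝔮
      δ∈ 𝔮 hasHeight with HasHeight⇒meets-codimIdeal hasHeight
      ... | j , j∈𝔮 , j-high with prime 𝔮 {ε (ℕ.suc d)} {ε d - ε (ℕ.suc d)}
        (↑-closed 𝔮 (trans (Codim≥⇒≤ε j-high) (x≤y∨[x-y] (ε d) (ε (ℕ.suc d)))) j∈𝔮)
      ... | inj₁ ε′∈𝔮 = contradiction (ε-high (ℕ.suc d) 𝔮 ε′∈𝔮) (proj₂ hasHeight)
      ... | inj₂ δ∈𝔮  = δ∈𝔮

    -- `x - ε n` is the least representative of `x` modulo nL, which turns inequalities modulo nL
    -- into inequalities in L.
    -ε≤ : ∀ {n x y} → x ≤[ n ] y → x - ε n ≤ y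
    -ε≤ {n} {x} {y} x≤y = -least (trans (x≤y∨[x-y] x y)
      (trans (∨-monotonic refl (Codim≥⇒≤ε x≤y)) (reflexive (∨-comm y (ε n)))))

    -ε-mono : ∀ {n x y} → x ≤[ n ] y → x - ε n ≤ y - ε n
    -ε-mono {n} {x} {y} x≤y = -ε≤ (CoHeytingAlgebra.trans (truncation L n) x≤y
      (↓-closed (-least (trans (x≤y∨[x-y] y (ε n)) (reflexive (∨-comm _ _)))) (ε-high n)))
      where open Ideal (codimIdeal L n)

    -- Prime filters of the projective limit

    L̂ : CoHeytingAlgebra _ _ _
    L̂ = projectiveLimit L

    module L̂ = CoHeytingAlgebra L̂
    module L/ (n : ℕ) = CoHeytingAlgebra (truncation L n)
    open Thread

    ι : Carrier → Thread L
    ι = diagonal L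

    at-≤ : ∀ x {m n} → m ℕ.≤ n → at x n ≤[ m ] at x m
    at-≤ x {m} m≤n = go (ℕ.≤⇒≤′ m≤n)
      where
      go : ∀ {n} → m ℕ.≤′ n → at x n ≤[ m ] at x m
      go ℕ.≤′-refl                    = L/.refl m
      go (ℕ.≤′-step {n = n} m≤′n) = L/.trans m
        (Codim≥-anti L (ℕ.≤′⇒≤ m≤′n) (L/.reflexive n (coherent x n))) (go m≤′n)

    at-≥ : ∀ x {m n} → m ℕ.≤ n → at x m ≤[ m ] at x n
    at-≥ x {m} m≤n = go (ℕ.≤⇒≤′ m≤n)
      where
      go : ∀ {n} → m ℕ.≤′ n → at x m ≤[ m ] at x n
      go ℕ.≤′-refl                    = L/.refl m
      go (ℕ.≤′-step {n = n} m≤′n) = L/.trans m (go m≤′n)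
        (Codim≥-anti L (ℕ.≤′⇒≤ m≤′n) (L/.reflexive n (L/.Eq.sym n (coherent x n))))

    Kernel : ℕ → Pred (Thread L) _
    Kernel d x = Codim≥ L d (at x d)

    -- At levels n ≥ d the component of `x` lies in dL, hence below `ε d`; at levels n ≤ d it
    -- vanishes modulo nL.
    kernel⇒≤ε : ∀ {d x} → Kernel d x → x L̂.≤ ι (ε d)
    kernel⇒≤ε {d} {x} x∈K n with ℕ.≤-total d n
    ... | inj₁ d≤n = ≤⇒≤[] (Codim≥⇒≤ε (Codim≥-≤[]-closed (at-≤ x d≤n) x∈K))
    ... | inj₂ n≤d = Codim≥⇒≤[]
      (Codim≥-≤[]-closed (at-≥ x n≤d) (Codim≥-anti L n≤d x∈K))

    ≤ε⇒kernel : ∀ {d x} → x L̂.≤ ι (ε d) → Kernel d x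
    ≤ε⇒kernel {d} x≤ε = Codim≥-≤[]-closed (x≤ε d) (ε-high d)

    -- The inverse image along the projection L̂ → L / nL, to which `𝔭` descends because its height
    -- is below `n`.
    lift : ∀ n 𝔭 → ¬ Height≥ L n 𝔭 →
           Σ[ 𝔓 ∈ PrimeFilter L̂ ] filter 𝔓 ≐ (λ x → at x n ∈ filter 𝔭)
    lift n 𝔭 𝔭-low = primeFilter L̂ (λ x → at x n ∈ filter 𝔭) (⊤-closed 𝔭) (∧-closed 𝔭)
      (λ x≤y → ≤[]-closed 𝔭-low (x≤y n)) (proper 𝔭) (prime 𝔭)

    -- The whole chain below `𝔭` lifts at the same level `n`; strictness is tested on diagonal
    -- threads.
    lift-height : ∀ {m n 𝔭} (𝔭-low : ¬ Height≥ L n 𝔭) → Height≥ L m 𝔭 →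
                  Height≥ L̂ m (proj₁ (lift n 𝔭 𝔭-low))
    lift-height 𝔭-low h-zero = h-zero
    lift-height {n = n} {𝔭} 𝔭-low (h-suc 𝔮 (𝔮⊆𝔭 , 𝔭⊈𝔮) h) =
      h-suc (proj₁ (lift n 𝔮 𝔮-low))
        ( (λ {x} x∈𝔔 → intoᵖ {x} (𝔮⊆𝔭 (outᑫ {x} x∈𝔔)))
        , (λ 𝔓⊆𝔔 → 𝔭⊈𝔮 (λ {y} y∈𝔭 → outᑫ {ι y} (𝔓⊆𝔔 {ι y} (intoᵖ {ι y} y∈𝔭)))))
        (lift-height 𝔮-low h)
      where
      𝔮-low : ¬ Height≥ L n 𝔮
      𝔮-low = 𝔭-low ∘ Height≥-mono L 𝔮⊆𝔭
      intoᵖ = proj₂ (proj₂ (lift n 𝔭 𝔭-low))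
      outᑫ = proj₁ (proj₂ (lift n 𝔮 𝔮-low))

    ι-mono : ∀ {x y} → x ≤ y → ι x L̂.≤ ι y
    ι-mono x≤y n = ≤⇒≤[] x≤y

    contract : (𝔓 : PrimeFilter L̂) → Σ[ 𝔭 ∈ PrimeFilter L ] filter 𝔭 ≐ (λ x → ι x ∈ filter 𝔓)
    contract 𝔓 = primeFilter L (λ x → ι x ∈ filter 𝔓)
      (⊤-closed 𝔓)
      (λ {x} {y} x∈ y∈ →
        ↑-closed 𝔓 {ι x L̂.∧ ι y} {ι (x ∧ y)} (λ n → L/.refl n) (∧-closed 𝔓 x∈ y∈))
      (λ {x} {y} x≤y → ↑-closed 𝔓 {ι x} {ι y} (ι-mono x≤y))
      (proper 𝔓)
      (λ {x} {y} x∨y∈ →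
        prime 𝔓 (↑-closed 𝔓 {ι (x ∨ y)} {ι x L̂.∨ ι y} (λ n → L/.refl n) x∨y∈))

    ≤[]-closed-at : ∀ {n} {𝔓 : PrimeFilter L̂} → (∀ {x} → Kernel n x → x ∉ filter 𝔓) →
                    ∀ {x y} → at x n ≤[ n ] at y n → x ∈ filter 𝔓 → y ∈ filter 𝔓
    ≤[]-closed-at {𝔓 = 𝔓} 𝔓-avoids {x} {y} x≤y x∈𝔓
      with prime 𝔓 {y} {x L̂.- y} (↑-closed 𝔓 (L̂.x≤y∨[x-y] x y) x∈𝔓)
    ... | inj₁ y∈𝔓   = y∈𝔓
    ... | inj₂ x-y∈𝔓 = contradiction x-y∈𝔓 (𝔓-avoids x≤y)

    -- A prime filter avoiding the kernel cannot tell `x` from `ι (at x n)`, so strict inclusions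
    -- between such filters stay strict on the diagonal.
    contract-height : ∀ {m n} {𝔓 : PrimeFilter L̂} → (∀ {x} → Kernel n x → x ∉ filter 𝔓) →
                      Height≥ L̂ m 𝔓 → Height≥ L m (proj₁ (contract 𝔓))
    contract-height 𝔓-avoids h-zero = h-zero
    contract-height {n = n} {𝔓} 𝔓-avoids (h-suc 𝔔 (𝔔⊆𝔓 , 𝔓⊈𝔔) h) =
      h-suc (proj₁ (contract 𝔔))
        ( (λ y∈𝔮 → intoᵖ (𝔔⊆𝔓 (outᑫ y∈𝔮)))
        , (λ 𝔭⊆𝔮 → 𝔓⊈𝔔 (λ {x} x∈𝔓 → ≤[]-closed-at {𝔓 = 𝔔} 𝔔-avoids {ι (at x n)} {x} (L/.refl n)
            (outᑫ (𝔭⊆𝔮 (intoᵖ (≤[]-closed-at {𝔓 = 𝔓} 𝔓-avoids {x} {ι (at x n)} (L/.refl n) x∈𝔓)))))))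
        (contract-height 𝔔-avoids h)
      where
      𝔔-avoids : ∀ {x} → Kernel n x → x ∉ filter 𝔔
      𝔔-avoids x∈K x∈𝔔 = 𝔓-avoids x∈K (𝔔⊆𝔓 x∈𝔔)
      intoᵖ = proj₂ (proj₂ (contract 𝔓))
      outᑫ = proj₁ (proj₂ (contract 𝔔))

    Codim≥⇒kernel : ∀ {d x} → Codim≥ L̂ d x → Kernel d x
    Codim≥⇒kernel {d} {x} x-high = by-contradiction contra
      where
      contra : ¬ ¬ Kernel d x
      contra x∉K with ¬Codim≥⇒prime x∉K
      ... | 𝔭 , x∈𝔭 , 𝔭-low with lift d 𝔭 𝔭-low
      -- `𝔓` contains `x`, so its height is at least `d`. As it avoids the kernel, the same holds
      -- for its contraction, which lies in `𝔭`.
      ... | 𝔓 , out , into = 𝔭-low (Height≥-mono L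
        (λ {y} y∈ → out {ι y} (proj₁ (proj₂ (contract 𝔓)) y∈))
        (contract-height avoids (x-high 𝔓 (into {x} x∈𝔭))))
        where
        avoids : ∀ {y} → Kernel d y → y ∉ filter 𝔓
        avoids {y} y∈K y∈𝔓 = 𝔭-low (y∈K 𝔭 (out {y} y∈𝔓))

    -- Levels up to `n` follow from coherence, later ones from minimality of the representative.
    -- This supplies a diagonal thread below a given thread.
    ι[-ε]≤ : ∀ n x → ι (at x n - ε n) L̂.≤ x
    ι[-ε]≤ n x m with ℕ.≤-total m n
    ... | inj₁ m≤n = L/.trans m {j = at x n} (≤⇒≤[] (-least (y≤x∨y _ _))) (at-≤ x m≤n)
    ... | inj₂ n≤m = ≤⇒≤[] (-ε≤ (at-≥ x n≤m))

    -- A prime filter 𝔓 of L̂ need not be lifted from L, so a lifted one of height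
    -- ≥ d is found inside it: N is an ideal of L containing (d + 1)L and missing
    -- ε d, and a prime filter 𝔭 of L that contains ε d and avoids N lifts into 𝔓.
    kernel⇒Codim≥ : ∀ {d x} → Kernel d x → Codim≥ L̂ d x
    kernel⇒Codim≥ {d} {x} x∈K 𝔓 x∈𝔓 = high
      where
      N : Pred Carrier _
      N y = ι (y - ε (ℕ.suc d)) ∉ filter 𝔓

      N-∨-closed : ∀ {y z} → y ∈ N → z ∈ N → y ∨ z ∈ N
      N-∨-closed {y} {z} y∈N z∈N y∨z∈𝔓 = [ y∈N , z∈N ]′
        (prime 𝔓 (↑-closed 𝔓 {y = ι (y - ε′) L̂.∨ ι (z - ε′)} (ι-mono (-least split)) y∨z∈𝔓))
        where
        ε′ = ε (ℕ.suc d)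
        split : y ∨ z ≤ ε′ ∨ (y - ε′ ∨ z - ε′)
        split = ∨-least
          (trans (x≤y∨[x-y] y ε′) (∨-monotonic refl (x≤x∨y _ _)))
          (trans (x≤y∨[x-y] z ε′) (∨-monotonic refl (y≤x∨y _ _)))

      N-↓-closed : ∀ {y z} → y ≤[ ℕ.suc d ] z → z ∈ N → y ∈ N
      N-↓-closed {y} {z} y≤z z∈N = z∈N ∘
        ↑-closed 𝔓 {ι (y - ε (ℕ.suc d))} {ι (z - ε (ℕ.suc d))} (ι-mono (-ε-mono y≤z))

      ⊥∈N : ⊥ ∈ N
      ⊥∈N = proper 𝔓 ∘ ↑-closed 𝔓 {ι (⊥ - ε (ℕ.suc d))} {L̂.⊥} (ι-mono (-least (minimum _)))

      ε∉N : ε d ∉ N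
      ε∉N ε∈N = ε∈N (↑-closed 𝔓 {x} {ι (ε d - ε (ℕ.suc d))}
        (L̂.trans {x} {ι (ε d)} {ι (ε d - ε (ℕ.suc d))}
          (kernel⇒≤ε {d} {x} x∈K) (ι-mono (ε-difference d))) x∈𝔓)

      separated : ∀ {b} → b ∈ N → (∀ {y} → y ∈ N → y ≤[ ℕ.suc d ] b) →
                  (∃[ 𝔭 ] ε d ∈ filter 𝔭 × b ∉ filter 𝔭 × ¬ Height≥ L (ℕ.suc d) 𝔭) →
                  Height≥ L̂ d 𝔓
      separated {b} b∈N ≤b (𝔭 , ε∈𝔭 , b∉𝔭 , 𝔭-low) =
        Height≥-mono L̂ lift⊆𝔓 (lift-height 𝔭-low (ε-high d 𝔭 ε∈𝔭))
        where
        lift⊆𝔓 : filter (proj₁ (lift (ℕ.suc d) 𝔭 𝔭-low)) ⊆ filter 𝔓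
        -- If the diagonal thread below `y` were missing from `𝔓`, then `at y (suc d)` would be in
        -- `N`, hence below `b` modulo (d+1)L, and `b` would lie in `𝔭`.
        lift⊆𝔓 {y} y∈ = ↑-closed 𝔓 {ι (at y (ℕ.suc d) - ε (ℕ.suc d))} {y} (ι[-ε]≤ (ℕ.suc d) y)
          (by-contradiction λ y∈N → b∉𝔭
            (≤[]-closed 𝔭-low (≤b y∈N) (proj₁ (proj₂ (lift (ℕ.suc d) 𝔭 𝔭-low)) {y} y∈)))

      high : Height≥ L̂ d 𝔓
      high = let b , b∈N , ≤b = Codim≥-bound d {N} N-∨-closed ⊥∈N N-↓-closed in
        separated b∈N ≤b (truncation-separates (precompact (ℕ.suc d))
          (λ ε≤b → ε∉N (N-↓-closed ε≤b b∈N)))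

    -- Topology and completeness of the projective limit

    dist̂ : DistanceFunction (Thread L)
    dist̂ = codimDist lem L̂

    Agree : ℕ → Rel (Thread L) _
    Agree n x y = L/._≈_ n (at x n) (at y n)

    at-≈ : ∀ x {m n} → m ℕ.≤ n → L/._≈_ m (at x n) (at x m)
    at-≈ x {m} m≤n = L/.antisym m (at-≤ x m≤n) (at-≥ x m≤n)

    Agree-anti : ∀ {x y m n} → m ℕ.≤ n → Agree n x y → Agree m x y
    Agree-anti {x} {y} {m} m≤n x~y = L/.Eq.trans m (L/.Eq.sym m (at-≈ x m≤n))
      (L/.Eq.trans m (Codim≥-anti L m≤n x~y) (at-≈ y m≤n))

    -- Operations on threads are pointwise, so agreement at a level is membership of `x △ y` in the
    -- kernel at that level.
    dist̂<⇒Agree : ∀ {n x y} → dist̂ x y ℚ.< 2^- n → Agree (ℕ.suc n) x y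
    dist̂<⇒Agree {n} {x} {y} d< = Codim≥⇒kernel {x = x L̂.△ y} (dist<⇒Codim≥ L̂ {n} {x} {y} d<)

    Agree⇒dist̂< : ∀ {n x y} → Agree (ℕ.suc n) x y → dist̂ x y ℚ.< 2^- n
    Agree⇒dist̂< {n} {x} {y} x~y = Codim≥⇒dist< L̂ {n} {x} {y} (kernel⇒Codim≥ {x = x L̂.△ y} x~y)

    ε-isGenerator : ∀ d → IsGenerator (codimIdeal L d) (ε d)
    ε-isGenerator d x = mk⇔ Codim≥⇒≤ε (λ x≤ε → Ideal.↓-closed (codimIdeal L d) x≤ε (ε-high d))

    ιε-isGenerator : ∀ d → IsGenerator (codimIdeal L̂ d) (ι (ε d))
    ιε-isGenerator d x = mk⇔
      (λ x-high → kernel⇒≤ε {d} {x} (Codim≥⇒kernel {x = x} x-high))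
      (λ x≤ε → kernel⇒Codim≥ {x = x} (≤ε⇒kernel {d} {x} x≤ε))

    closure-codimIdeal : ∀ d →
      Closure (ProjectiveOpen L) (Image L̂.setoid ι (member (codimIdeal L d)))
        ≐ member (codimIdeal L̂ d)
    closure-codimIdeal d = ⊆dL̂ , dL̂⊆
      where
      S = Image L̂.setoid ι (member (codimIdeal L d))

      ⊆dL̂ : Closure (ProjectiveOpen L) S ⊆ member (codimIdeal L̂ d)
      ⊆dL̂ {x} x∈S̄ =
        -- The closure condition is tested on the fibre of L̂ → L / dL through `x`, which is open.
        let y , y~x , z , z-high , ιz≈y = x∈S̄ (λ y → Agree d y x)
              (λ y y~x → (d ∷ []) , λ { w (w~y ∷ []) → L/.Eq.trans d w~y y~x })
              (L/.Eq.refl d)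
        in  kernel⇒Codim≥ {x = x} (Codim≥-≤[]-closed
              (L/.reflexive d (L/.Eq.sym d (L/.Eq.trans d (ιz≈y d) y~x))) z-high)

      dL̂⊆ : member (codimIdeal L̂ d) ⊆ Closure (ProjectiveOpen L) S
      dL̂⊆ {x} x-high U U-open x∈U =
        let is , near⊆U = U-open x x∈U
            -- At least `d`, so that `at x n` lies in dL, and at least every level in `is`, so that
            -- `ι (at x n)` lies in the neighbourhood.
            n = max d is
            z-high = Codim≥-≤[]-closed (at-≤ x (v≤max⁺ d is (inj₁ ℕ.≤-refl)))
              (Codim≥⇒kernel {x = x} x-high)
        in  ι (at x n)
          , near⊆U (ι (at x n)) (All.map (at-≈ x) (xs≤max d is))
          , at x n , z-high , L̂.Eq.refl {ι (at x n)}

    ι-isIsomorphism : ∀ d → IsCoHeytingIsomorphism (L /ᴵ codimIdeal L d)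
                              (projectiveLimit L /ᴵ codimIdeal (projectiveLimit L) d) (diagonal L)
    ι-isIsomorphism d = quotient-isomorphism (diagonal-isHomomorphism L)
      (codimIdeal L d) (codimIdeal (projectiveLimit L) d)
      (λ {x} → kernel⇒Codim≥ {x = ι x}) (λ {x} → Codim≥⇒kernel {x = ι x})
      (λ y → at y d , kernel⇒Codim≥
        {x = CoHeytingAlgebra._△_ (projectiveLimit L) (diagonal L (at y d)) y} (L/.Eq.refl d))

    projective⇔metric : (U : Pred (Thread L) _) → ProjectiveOpen L U ⇔ MetricOpen dist̂ U
    projective⇔metric U = mk⇔ to from
      where
      to : ProjectiveOpen L U → MetricOpen dist̂ U
      to U-open x x∈U =
        let is , near⊆U = U-open x x∈U
            -- Agreement at the largest tested level implies it at all of them; the default 0 covers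
            -- the empty list.
            n = max 0 is
        in  2^- n , 0<2^- n , λ y d< → near⊆U y (All.map
              (λ {i} i≤n → L/.Eq.sym i (Agree-anti {x} {y}
                (ℕ.≤-trans i≤n (ℕ.n≤1+n n)) (dist̂<⇒Agree {n} {x} {y} d<)))
              (xs≤max 0 is))

      from : MetricOpen dist̂ U → ProjectiveOpen L U
      from U-open x x∈U =
        let r , 0<r , ball⊆U = U-open x x∈U
            n , 2^-n<r = 2^-small 0<r
        in  (ℕ.suc n ∷ []) , λ { y (y~x ∷ []) → ball⊆U y (ℚ.<-trans
              (Agree⇒dist̂< {n} {x} {y} (L/.Eq.sym (ℕ.suc n) y~x)) 2^-n<r) }

    Codim≥-separated : ∀ {x y} → (∀ n → Codim≥ L n (x △ y)) → x ≈ y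
    Codim≥-separated x≡y = antisym (below x≡y) (below λ n → L/.Eq.sym n (x≡y n))
      where
      below : ∀ {x y} → (∀ n → Codim≥ L n (x △ y)) → x ≤ y
      below x≡y = by-contradiction λ x≰y →
        let n , 𝔭 , x∈𝔭 , y∉𝔭 , 𝔭-low = separates x≰y
        in  y∉𝔭 (≤[]-closed 𝔭-low (L/.reflexive n (x≡y n)) x∈𝔭)

    module _ {u : ℕ → Thread L} (u-cauchy : Cauchy dist̂ u) where

      modulus : ℕ → ℕ
      modulus n = proj₁ (u-cauchy (2^- n) (0<2^- n))

      modulus-agree : ∀ n {i j} → modulus n ℕ.≤ i → modulus n ℕ.≤ j → Agree n (u i) (u j)
      modulus-agree n {i} {j} N≤i N≤j = Agree-anti {u i} {u j} (ℕ.n≤1+n n)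
        (dist̂<⇒Agree {n} {u i} {u j} (proj₂ (u-cauchy (2^- n) (0<2^- n)) i j N≤i N≤j))

      -- All terms from `modulus n` on agree at level `n`, so the first of them fixes the limit
      -- there.
      limit : Thread L
      limit = record
        { at       = λ n → at (u (modulus n)) n
        ; coherent = λ n →
            let N = modulus n
                N′ = modulus (ℕ.suc n)
                -- A common later index links the terms chosen for levels `n` and n + 1.
                K = N ℕ.⊔ N′
            in  L/.Eq.trans n (coherent (u N′) n) (L/.Eq.trans n
                  (Agree-anti {u N′} {u K} (ℕ.n≤1+n n)
                    (modulus-agree (ℕ.suc n) ℕ.≤-refl (ℕ.m≤n⊔m N N′)))
                  (modulus-agree n (ℕ.m≤m⊔n N N′) ℕ.≤-refl))
        }

      converges : ConvergesTo dist̂ u limit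
      converges r 0<r =
        let n , 2^-n<r = 2^-small 0<r
        in  modulus (ℕ.suc n) , λ m N≤m → ℚ.<-trans
              (Agree⇒dist̂< {n} {u m} {limit} (modulus-agree (ℕ.suc n) N≤m ℕ.≤-refl)) 2^-n<r

    isCompletion : IsCompletion setoid (codimDist lem L) L̂.setoid dist̂ ι
    isCompletion = record
      { isMetricᴬ = dist-isMetric L Codim≥-separated
      ; isMetricᴮ = dist-isMetric L̂ (λ {x} {y} x≡y n → Codim≥⇒kernel {x = x L̂.△ y} (x≡y n))
      -- On diagonal threads the kernel at level `n` is just nL, so differences have the same
      -- codimension in L and in L̂.
      ; isometric = λ x y → ℚ.≤-antisym
          (dist-mono L L̂ {x} {y} {ι x} {ι y} λ n → kernel⇒Codim≥ {x = ι x L̂.△ ι y})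
          (dist-mono L̂ L {ι x} {ι y} {x} {y} λ n → Codim≥⇒kernel {x = ι x L̂.△ ι y})
      ; dense     = λ y r 0<r →
          let n , 2^-n<r = 2^-small 0<r
              x = at y (ℕ.suc n)
          in  x , ℚ.<-trans (Agree⇒dist̂< {n} {ι x} {y} (L/.Eq.refl (ℕ.suc n))) 2^-n<r
      ; complete  = λ u u-cauchy → limit u-cauchy , converges u-cauchy
      }

theorem6p1 :
    (lem : ∀ {ℓ} → ExcludedMiddle ℓ) →
    ∀ {c ℓ₁ ℓ₂} (L : CoHeytingAlgebra c ℓ₁ ℓ₂) → Hausdorff L → Precompact L →
    let L̂  = projectiveLimit L
        ι  = diagonal L
        open CoHeytingAlgebra
    in
      ((d : ℕ) .{{_ : NonZero d}} →
        (Σ[ e ∈ Carrier L ] Σ[ ê ∈ Carrier L̂ ]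
           (IsGenerator (codimIdeal L d) e × IsGenerator (codimIdeal L̂ d) ê
             × _≈_ L̂ (ι e) ê))
        × (Closure (ProjectiveOpen L) (Image (setoid L̂) ι (member (codimIdeal L d)))
             ≐ member (codimIdeal L̂ d))
        × IsCoHeytingIsomorphism (L /ᴵ codimIdeal L d) (L̂ /ᴵ codimIdeal L̂ d) ι)
      × ((U : Pred (Carrier L̂) (suc (c ⊔ ℓ₁ ⊔ ℓ₂))) →
           ProjectiveOpen L U ⇔ MetricOpen (codimDist lem L̂) U)
      × IsCompletion (setoid L) (codimDist lem L) (setoid L̂) (codimDist lem L̂) ι
theorem6p1 lem L hausdorff precompact =
    (λ d → (ε d , ι (ε d) , ε-isGenerator d , ιε-isGenerator d , L̂.Eq.refl {ι (ε d)})
         , closure-codimIdeal d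
         , ι-isIsomorphism d)
  , projective⇔metric
  , isCompletion
  where
  open Classical lem
  open Completion L hausdorff precompact
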